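{- Let $\mathrm{H}$ be a finite group and let $\sigma \in \mathrm{Aut}(\mathrm{H})$ satisfy $\sigma^2 = \mathrm{Id}$. Then there exists an $(\mathrm{H},\sigma)$-graph $\Gamma = (V,E)$ which is connected, nonbipartite, and has exactly $|\mathrm{H}| \cdot (7 + \max(\mathrm{rank}(\mathrm{H}),5))$ vertices. Moreover, every orbit of the action of $\mathrm{Aut}^{\pi}(\Gamma)$ on $V$ consists of exactly $|\mathrm{H}|$ vertices, and the subgraph of $\Gamma$ induced by any such orbit has no edges.
   Context: All graphs are finite, simple and loopless. For a vertex $v$, $N(v)=\{w : (v,w)\in E\}$. A graph is reduced if $N(v)=N(w)$ implies $v=w$. For a reduced graph $\Gamma$, $\mathrm{Aut}^{\pi}(\Gamma)$ (two-fold projections) is the group of bijections $\pi: V\to V$ such that for every $v\in V$ there is $w \in V$ with $\pi(N(v)) = N(w)$. For $\pi \in \mathrm{Aut}^{\pi}(\Gamma)$, $\gamma(\pi)$ is the permutation of $V$ defined by $\gamma(\pi)(v) = w$ where $w$ is the unique vertex with $N(w) = \pi(N(v))$. An $(\mathrm{H},\sigma)$-graph is a reduced graph $\Gamma$ for which there is a group isomorphism $\psi: \mathrm{Aut}^{\pi}(\Gamma) \to \mathrm{H}$ with $\sigma = \psi \circ \gamma \circ \psi^{ -1}$. $\mathrm{rank}(\mathrm{H})$ is the minimal cardinality of a generating set of $\mathrm{H}$. -}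

module Defs where

open import Data.Nat using (ℕ; _≤_; _*_; _+_; _⊔_)
open import Data.Fin using (Fin)
open import Data.Fin.Subset using (Subset; _∈_; ∣_∣)
open import Data.Fin.Permutation using (Permutation′; _⟨$⟩ʳ_; _⟨$⟩ˡ_)
open import Data.Bool using (Bool; true; false)
open import Data.Vec using (Vec; tabulate)
open import Data.Product using (Σ; _×_; _,_; proj₁; proj₂)
open import Relation.Binary.PropositionalEquality using (_≡_; _≢_)
open import Relation.Nullary using (¬_)
open import Algebra.Structures using (IsGroup)
open import Function.Definitions using (Bijective)

-- Finite groups: a group structure on Fin m (with _≡_ as equality).
-- Every finite group of order m is isomorphic to one of these.

record FiniteGroup : Set where
  field
    order   : ℕ
    _∙_     : Fin order → Fin order → Fin order
    ε       : Fin order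
    _⁻¹     : Fin order → Fin order
    isGroup : IsGroup _≡_ _∙_ ε _⁻¹

module _ (H : FiniteGroup) where
  open FiniteGroup H

  IsAutomorphism : (Fin order → Fin order) → Set
  IsAutomorphism σ =
    (∀ x y → σ (x ∙ y) ≡ σ x ∙ σ y) × Bijective _≡_ _≡_ σ

  data Generated (S : Subset order) : Fin order → Set where
    gen : ∀ {x} → x ∈ S → Generated S x
    one : Generated S ε
    mul : ∀ {x y} → Generated S x → Generated S y → Generated S (x ∙ y)
    inv : ∀ {x} → Generated S x → Generated S (x ⁻¹)

  Generates : Subset order → Set
  Generates S = ∀ x → Generated S x

  IsRank : ℕ → Set
  IsRank r = (Σ (Subset order) λ S → Generates S × ∣ S ∣ ≡ r)
           × (∀ S → Generates S → r ≤ ∣ S ∣)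

record Graph (n : ℕ) : Set where
  field
    adj      : Fin n → Fin n → Bool
    sym      : ∀ x y → adj x y ≡ adj y x
    loopless : ∀ x → adj x x ≡ false

module _ {n : ℕ} (Γ : Graph n) where
  open Graph Γ

  N : Fin n → Vec Bool n
  N v = tabulate (adj v)

  Reduced : Set
  Reduced = ∀ v w → N v ≡ N w → v ≡ w

  -- π(N(v)) : w ∈ π(N(v)) iff π⁻¹(w) ∈ N(v)
  image : Permutation′ n → Fin n → Vec Bool n
  image π v = tabulate (λ w → adj v (π ⟨$⟩ˡ w))

  IsTwoFold : Permutation′ n → Set
  IsTwoFold π = ∀ v → Σ (Fin n) λ w → image π v ≡ N w

  AutPi : Set
  AutPi = Σ (Permutation′ n) IsTwoFold

  app : AutPi → Fin n → Fin n
  app p x = proj₁ p ⟨$⟩ʳ x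

  _≈π_ : AutPi → AutPi → Set
  p ≈π q = ∀ x → app p x ≡ app q x

  -- γ(π)(v) = the (unique, Γ reduced) w with N(w) = π(N(v))
  γ : AutPi → Fin n → Fin n
  γ p v = proj₁ (proj₂ p v)

  data Reachable : Fin n → Fin n → Set where
    here : ∀ {x} → Reachable x x
    step : ∀ {x y z} → adj x y ≡ true → Reachable y z → Reachable x z

  Connected : Set
  Connected = ∀ x y → Reachable x y

  Bipartite : Set
  Bipartite = Σ (Fin n → Bool) λ c → ∀ x y → adj x y ≡ true → c x ≢ c y

  InOrbit : Fin n → Fin n → Set
  InOrbit v w = Σ AutPi λ p → app p v ≡ w

  OrbitSize : Fin n → ℕ → Set
  OrbitSize v k = Σ (Fin k → Fin n) λ f →
      (∀ i j → f i ≡ f j → i ≡ j)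
    × (∀ i → InOrbit v (f i))
    × (∀ w → InOrbit v w → Σ (Fin k) λ i → f i ≡ w)

-- Γ is an (H,σ)-graph: reduced, and there is an isomorphism
-- φ = ψ⁻¹ : H → Aut^π(Γ) (composition = function composition)
-- with γ ∘ φ = φ ∘ σ, i.e. σ = ψ ∘ γ ∘ ψ⁻¹.

IsHσGraph : (H : FiniteGroup) → (Fin (FiniteGroup.order H) → Fin (FiniteGroup.order H))
          → {n : ℕ} → Graph n → Set
IsHσGraph H σ {n} Γ = Reduced Γ × Σ (Fin order → AutPi Γ) λ φ →
    (∀ a b x → app Γ (φ (a ∙ b)) x ≡ app Γ (φ a) (app Γ (φ b) x))
  × (∀ a b → _≈π_ Γ (φ a) (φ b) → a ≡ b)
  × (∀ p → Σ (Fin order) λ a → _≈π_ Γ (φ a) p)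
  × (∀ a v → γ Γ (φ a) v ≡ app Γ (φ (σ a)) v)
  where open FiniteGroup H

{-# OPTIONS --safe #-}
module Submission where

-- Put V = H × [k] and join (h , i) to (g , j) when the pair (i , j) carries a
-- voltage s ∈ H and h = σ(g) s. Then h ↦ σ(a)h together with g ↦ ag preserves
-- adjacency, so left translations are two-fold projections on which γ acts as σ.
-- To exclude all others, the base graph on [k] is chosen so that each layer
-- H × {i} is definable from adjacency alone (a leaf, its neighbour, …) and is
-- therefore preserved. The links of voltage 1 form a connected nonbipartite
-- graph, which forces one and the same map A : H → H on all layers (up to
-- conjugation by σ), and a link of voltage s forces A(xs) = A(x)s. As the
-- voltages generate H, A is a left translation.

open import Defs
open import Algebra.Bundles using (Group)
import Algebra.Properties.Group as GroupProperties
open import Data.Bool using (Bool; true; false; if_then_else_)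
open import Data.Bool.Properties using (⇔→≡; ¬-not)
open import Data.Nat using (ℕ; zero; suc; _≤_; _*_; _+_; _⊔_; z≤n; s≤s)
import Data.Nat.Properties as ℕ
open import Data.Fin using (Fin; zero; suc; toℕ; inject₁; combine; remQuot; punchOut)
open import Data.Fin.Patterns
open import Data.Fin.Properties
  using (_≟_; any?; all?; injective⇒≤; punchOut-injective; toℕ-inject₁; toℕ-injective; combine-remQuot; remQuot-combine)
open import Data.Fin.Induction using (<-weakInduction)
open import Data.Fin.Permutation using (Permutation′; permutation; _⟨$⟩ʳ_; _⟨$⟩ˡ_)
import Data.Fin.Permutation as Perm
open import Data.Fin.Permutation.Components using (transpose; transpose-inverse)
open import Data.Fin.Subset using (Subset; inside; outside; ⁅_⁆; _∪_; _∈_; _⊆_; _⊃_; ∣_∣; ⊤)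
open import Data.Fin.Subset.Properties
  using (_∈?_; x∈p∪q⁻; x∈⁅x⁆; x∈⁅y⁆⇒x≡y; p⊆p∪q; q⊆p∪q; ∈⊤; anySubset?)
open import Data.Fin.Subset.Induction using (⊃-wellFounded; Acc; acc)
open import Data.Maybe using (Maybe; just; nothing; maybe)
import Data.Maybe as Maybe
open import Data.Maybe.Properties using (just-injective)
open import Data.Product using (Σ; _×_; _,_; proj₁; proj₂; ∃; ∃₂)
open import Data.Sum using (_⊎_; inj₁; inj₂; [_,_]′; swap)
open import Data.Vec using ([]; _∷_; here; there; lookup)
open import Data.Vec.Properties using (lookup∘tabulate; tabulate-cong)
open import Function using (_∘_; const; mk⇔)
open import Function.Definitions using (Injective)
open import Relation.Nullary using (¬_; Dec; does; yes; no; contradiction)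
open import Relation.Nullary.Decidable
  using (dec-true; dec-false; _⊎-dec_; _×-dec_; ¬?; decidable-stable; map′)
open import Relation.Unary using (Decidable)
open import Relation.Binary.PropositionalEquality

-- Finite search and the existence of the rank.

least : (P : ℕ → Set) → Decidable P → ∀ n → P n → Σ ℕ λ r → P r × (∀ k → P k → r ≤ k)
least P P? n pn with P? 0
... | yes p0 = 0 , p0 , λ _ _ → z≤n
least P P? zero pn | no ¬p0 = contradiction pn ¬p0
least P P? (suc n) pn | no ¬p0 with least (P ∘ suc) (P? ∘ suc) n pn
... | r , pr , minimal = suc r , pr , λ where
  zero p0 → contradiction p0 ¬p0
  (suc k) pk → s≤s (minimal k pk)

-- A missed value `y` could be punched out of the codomain, leaving an injection from `suc n`
-- elements into `n`.
injective⇒hits : ∀ {n} {f : Fin n → Fin n} → Injective _≡_ _≡_ f → ∀ y → ∃ λ x → f x ≡ y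
injective⇒hits {suc n} {f} inj y with any? (λ x → f x ≟ y)
... | yes hit = hit
... | no miss = contradiction
  (injective⇒≤ {f = λ x → punchOut (y≢f x)} λ {x} {x′} eq → inj (punchOut-injective (y≢f x) (y≢f x′) eq))
  ℕ.1+n≰n
  where
  y≢f : ∀ x → y ≢ f x
  y≢f x eq = miss (x , sym eq)

-- The element of `A` is a default that pads the list when `S` has fewer than `K` members. The map
-- `f` is general so that the recursion can shift indices with `f ∘ suc`.
enumerate : ∀ {A : Set} {n K} (S : Subset n) → ∣ S ∣ ≤ K → A → (f : Fin n → A) →
  Σ (Fin K → A) λ e → ∀ {x} → x ∈ S → ∃ λ j → e j ≡ f x
enumerate [] _ d _ = const d , λ ()
enumerate (outside ∷ S) le d f with enumerate S le d (f ∘ suc)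
... | e , hits = e , λ where (there x∈S) → hits x∈S
enumerate {A} {K = suc K} (inside ∷ S) (s≤s le) d f with enumerate S le d (f ∘ suc)
... | e , hits = e′ , λ where
    here → zero , refl
    (there x∈S) → suc (proj₁ (hits x∈S)) , proj₂ (hits x∈S)
  where
  e′ : Fin (suc K) → A
  e′ zero    = f zero
  e′ (suc j) = e j

group : FiniteGroup → Group _ _
group H = record { isGroup = FiniteGroup.isGroup H }

module _ (H : FiniteGroup) where
  open Group (group H) using (_∙_; ε; _⁻¹; identityˡ; inverseʳ)
  open GroupProperties (group H) using (⁻¹-involutive)
  open FiniteGroup H using (order)

  -- Missing quotients `y ∙ z ⁻¹` are added to `T` one at a time, which must stop because `T` grows
  -- strictly. A set that contains `ε` and is closed under quotients is a subgroup, so membership in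
  -- the final set decides `Generated`.
  saturate : ∀ S T → Acc _⊃_ T → S ⊆ T → ε ∈ T → (∀ {x} → x ∈ T → Generated H S x) →
    Σ (Subset order) λ T′ → (∀ {x} → x ∈ T′ → Generated H S x) × (∀ {x} → Generated H S x → x ∈ T′)
  saturate S T (acc larger) S⊆T ε∈T sound
    with any? (λ y → any? (λ z → (y ∈? T) ×-dec (z ∈? T) ×-dec ¬? ((y ∙ z ⁻¹) ∈? T)))
  ... | yes (y , z , y∈T , z∈T , w∉T) = saturate S (T ∪ ⁅ w ⁆)
      (larger (p⊆p∪q ⁅ w ⁆ , w , q⊆p∪q T ⁅ w ⁆ (x∈⁅x⁆ w) , w∉T))
      (p⊆p∪q ⁅ w ⁆ ∘ S⊆T) (p⊆p∪q ⁅ w ⁆ ε∈T)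
      ([ sound , (λ x∈w → subst (Generated H S) (sym (x∈⁅y⁆⇒x≡y w x∈w)) (mul (sound y∈T) (inv (sound z∈T)))) ]′
        ∘ x∈p∪q⁻ T ⁅ w ⁆)
    where
    w = y ∙ z ⁻¹
  ... | no none = T , sound , complete
    where
    quotient : ∀ {y z} → y ∈ T → z ∈ T → (y ∙ z ⁻¹) ∈ T
    quotient y∈T z∈T = decidable-stable (_ ∈? T) λ w∉T → none (_ , _ , y∈T , z∈T , w∉T)
    inverse : ∀ {x} → x ∈ T → (x ⁻¹) ∈ T
    inverse x∈T = subst (_∈ T) (identityˡ _) (quotient ε∈T x∈T)
    complete : ∀ {x} → Generated H S x → x ∈ T
    complete (gen x∈S) = S⊆T x∈S
    complete one = ε∈T
    complete (mul {x} {y} p q) =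
      subst (λ z → (x ∙ z) ∈ T) (⁻¹-involutive y) (quotient (complete p) (inverse (complete q)))
    complete (inv p) = inverse (complete p)

  generates? : Decidable (Generates H)
  generates? S = all? λ x → map′ (proj₁ (proj₂ span)) (proj₂ (proj₂ span)) (x ∈? proj₁ span)
    where
    span = saturate S (S ∪ ⁅ ε ⁆) (⊃-wellFounded _) (p⊆p∪q ⁅ ε ⁆) (q⊆p∪q S ⁅ ε ⁆ (x∈⁅x⁆ ε))
      ([ gen , (λ x∈ε → subst (Generated H S) (sym (x∈⁅y⁆⇒x≡y ε x∈ε)) one) ]′ ∘ x∈p∪q⁻ S ⁅ ε ⁆)

  rank-exists : Σ ℕ (IsRank H)
  rank-exists with least
    (λ r → Σ (Subset order) λ S → Generates H S × ∣ S ∣ ≡ r)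
    (λ r → anySubset? λ S → generates? S ×-dec (∣ S ∣ ℕ.≟ r))
    ∣ ⊤ {order} ∣ (⊤ , (λ _ → gen ∈⊤) , refl)
  ... | r , attained , minimal = r , attained , λ S generates → minimal ∣ S ∣ (S , generates , refl)

dec-true⁻¹ : ∀ {P : Set} (P? : Dec P) → does P? ≡ true → P
dec-true⁻¹ (yes p) _ = p

-- Two-fold projections as symmetric pairs of bijections.

module _ {n : ℕ} (Γ : Graph n) where
  open Graph Γ using (adj)

  -- A two-fold projection π together with γ(π) is a pair (β, α) of bijections
  -- with α(x) ~ β(y) iff x ~ y, a notion which is symmetric in α and β.
  record Symmetry : Set where
    field
      α α⁻ β β⁻ : Fin n → Fin n
      α-α⁻ : ∀ x → α (α⁻ x) ≡ x
      α⁻-α : ∀ x → α⁻ (α x) ≡ x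
      β-β⁻ : ∀ x → β (β⁻ x) ≡ x
      β⁻-β : ∀ x → β⁻ (β x) ≡ x
      preserves : ∀ x y → adj (α x) (β y) ≡ adj x y

    preserves-pull : ∀ x y → adj (α x) y ≡ true → adj x (β⁻ y) ≡ true
    preserves-pull x y e = trans (sym (preserves x (β⁻ y))) (trans (cong (adj (α x)) (β-β⁻ y)) e)

  inverse : Symmetry → Symmetry
  inverse t = record
    { α = α⁻ ; α⁻ = α ; β = β⁻ ; β⁻ = β
    ; α-α⁻ = α⁻-α ; α⁻-α = α-α⁻ ; β-β⁻ = β⁻-β ; β⁻-β = β-β⁻
    ; preserves = λ x y → trans (sym (preserves (α⁻ x) (β⁻ y))) (cong₂ adj (α-α⁻ x) (β-β⁻ y))
    }
    where open Symmetry t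

  exchange : Symmetry → Symmetry
  exchange t = record
    { α = β ; α⁻ = β⁻ ; β = α ; β⁻ = α⁻
    ; α-α⁻ = β-β⁻ ; α⁻-α = β⁻-β ; β-β⁻ = α-α⁻ ; β⁻-β = α⁻-α
    ; preserves = λ x y → trans (Graph.sym Γ (β x) (α y)) (trans (preserves y x) (Graph.sym Γ y x))
    }
    where open Symmetry t

  N-injective : ∀ {v w} → N Γ v ≡ N Γ w → ∀ u → adj v u ≡ adj w u
  N-injective {v} {w} eq u =
    trans (sym (lookup∘tabulate (adj v) u)) (trans (cong (λ z → lookup z u) eq) (lookup∘tabulate (adj w) u))

  -- Here `β` is π and `α` is γ(π); preservation restates N(γ(π)(x)) = π(N(x)). Reducedness makes
  -- γ(π) injective, and finiteness then makes it bijective.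
  autSymmetry : Reduced Γ → AutPi Γ → Symmetry
  autSymmetry reduced p@(π , twofold) = record
    { α = γ Γ p ; α⁻ = proj₁ ∘ hit ; β = π ⟨$⟩ʳ_ ; β⁻ = π ⟨$⟩ˡ_
    ; α-α⁻ = proj₂ ∘ hit ; α⁻-α = λ x → γ-injective (proj₂ (hit (γ Γ p x)))
    ; β-β⁻ = λ x → Perm.inverseʳ π ; β⁻-β = λ x → Perm.inverseˡ π
    ; preserves = preserves
    }
    where
    preserves : ∀ x y → adj (γ Γ p x) (π ⟨$⟩ʳ y) ≡ adj x y
    preserves x y = begin
      adj (γ Γ p x) (π ⟨$⟩ʳ y)            ≡⟨ lookup∘tabulate (adj (γ Γ p x)) _ ⟨
      lookup (N Γ (γ Γ p x)) (π ⟨$⟩ʳ y)   ≡⟨ cong (λ z → lookup z _) (proj₂ (twofold x)) ⟨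
      lookup (image Γ π x) (π ⟨$⟩ʳ y)     ≡⟨ lookup∘tabulate (λ w → adj x (π ⟨$⟩ˡ w)) _ ⟩
      adj x (π ⟨$⟩ˡ (π ⟨$⟩ʳ y))           ≡⟨ cong (adj x) (Perm.inverseˡ π) ⟩
      adj x y                             ∎
      where open ≡-Reasoning
    γ-injective : ∀ {x y} → γ Γ p x ≡ γ Γ p y → x ≡ y
    γ-injective {x} {y} eq = reduced x y (tabulate-cong λ u →
      trans (sym (preserves x u)) (trans (cong (λ z → adj z (π ⟨$⟩ʳ u)) eq) (preserves y u)))
    hit = injective⇒hits γ-injective

  -- Vertices with equal neighbourhoods can be swapped by `α` while `β` stays the identity. This is
  -- the test symmetry from which reducedness is derived.
  twinSymmetry : ∀ x y → (∀ u → adj x u ≡ adj y u) →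
    Σ Symmetry λ t → (Symmetry.α t x ≡ y) × (∀ u → Symmetry.β t u ≡ u)
  twinSymmetry x y twins = record
    { α = transpose x y ; α⁻ = transpose y x ; β = λ u → u ; β⁻ = λ u → u
    ; α-α⁻ = λ _ → transpose-inverse x y ; α⁻-α = λ _ → transpose-inverse y x
    ; β-β⁻ = λ _ → refl ; β⁻-β = λ _ → refl
    ; preserves = preserves
    } , moves , λ _ → refl
    where
    moves : transpose x y x ≡ y
    moves rewrite dec-true (x ≟ x) refl = refl
    preserves : ∀ v u → adj (transpose x y v) u ≡ adj v u
    preserves v u with v ≟ x
    ... | yes refl = sym (twins u)
    ... | no _ with v ≟ y
    ...   | yes refl = twins u
    ...   | no _ = refl

  reachable-trans : ∀ {x y z} → Reachable Γ x y → Reachable Γ y z → Reachable Γ x z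
  reachable-trans here q = q
  reachable-trans (step e p) q = step e (reachable-trans p q)

  reachable-edge : ∀ {x y} → adj x y ≡ true → Reachable Γ x y
  reachable-edge e = step e here

  reachable-sym : ∀ {x y} → Reachable Γ x y → Reachable Γ y x
  reachable-sym here = here
  reachable-sym (step {x} {y} e p) =
    reachable-trans (reachable-sym p) (reachable-edge (trans (Graph.sym Γ y x) e))

-- Voltage graphs twisted by the involution.

module Twisted (H : FiniteGroup) (σ : Fin (FiniteGroup.order H) → Fin (FiniteGroup.order H))
  (σ-∙ : ∀ x y → σ (FiniteGroup._∙_ H x y) ≡ FiniteGroup._∙_ H (σ x) (σ y))
  (σ-involutive : ∀ x → σ (σ x) ≡ x) where

  open FiniteGroup H public using (order)
  open Group (group H) public using (_∙_; ε; _⁻¹; identityˡ; identityʳ; inverseʳ; inverseˡ; assoc)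
  open GroupProperties (group H) public
    using (⁻¹-involutive; ε⁻¹≈ε; ∙-cancelˡ; ∙-cancelʳ; x≈z//y; identityʳ-unique; inverseʳ-unique; //-rightDividesˡ)

  σ-injective : ∀ {x y} → σ x ≡ σ y → x ≡ y
  σ-injective {x} {y} eq = trans (sym (σ-involutive x)) (trans (cong σ eq) (σ-involutive y))

  σ-ε : σ ε ≡ ε
  σ-ε = identityʳ-unique (σ ε) (σ ε) (trans (sym (σ-∙ ε ε)) (cong σ (identityˡ ε)))

  σ-⁻¹ : ∀ x → σ (x ⁻¹) ≡ σ x ⁻¹
  σ-⁻¹ x = inverseʳ-unique (σ x) (σ (x ⁻¹)) (trans (sym (σ-∙ x (x ⁻¹))) (trans (cong σ (inverseʳ x)) σ-ε))

  -- The voltage of a reversed link: `h ≡ σ g ∙ s` is equivalent to `g ≡ σ h ∙ τ s`.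
  τ : Fin order → Fin order
  τ x = σ x ⁻¹

  τ-involutive : ∀ x → τ (τ x) ≡ x
  τ-involutive x = trans (cong _⁻¹ (σ-⁻¹ (σ x))) (trans (⁻¹-involutive _) (σ-involutive x))

  τ-ε : τ ε ≡ ε
  τ-ε = trans (cong _⁻¹ σ-ε) ε⁻¹≈ε

  module VoltageGraph {k : ℕ} (volt : Fin k → Fin k → Maybe (Fin order))
    (volt-sym : ∀ i j {s} → volt i j ≡ just s → volt j i ≡ just (τ s))
    (volt-loopless : ∀ i → volt i i ≡ nothing) where

    Vertex : Set
    Vertex = Fin (order * k)

    vertex : Fin order → Fin k → Vertex
    vertex = combine

    elt : Vertex → Fin order
    elt x = proj₁ (remQuot {order} k x)

    layer : Vertex → Fin k
    layer x = proj₂ (remQuot {order} k x)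

    elt-vertex : ∀ h i → elt (vertex h i) ≡ h
    elt-vertex h i = cong proj₁ (remQuot-combine h i)

    layer-vertex : ∀ h i → layer (vertex h i) ≡ i
    layer-vertex h i = cong proj₂ (remQuot-combine h i)

    vertex-η : ∀ x → vertex (elt x) (layer x) ≡ x
    vertex-η x = combine-remQuot {order} k x

    vertex-≡ : ∀ {x y} → elt x ≡ elt y → layer x ≡ layer y → x ≡ y
    vertex-≡ {x} {y} e l = trans (sym (vertex-η x)) (trans (cong₂ vertex e l) (vertex-η y))

    Edge : Vertex → Vertex → Set
    Edge x y = Σ (Fin order) λ s → volt (layer x) (layer y) ≡ just s × elt x ≡ σ (elt y) ∙ s

    adjacent : Vertex → Vertex → Bool
    adjacent x y = maybe (λ s → does (elt x ≟ σ (elt y) ∙ s)) false (volt (layer x) (layer y))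

    adjacent⇒edge : ∀ {x y} → adjacent x y ≡ true → Edge x y
    adjacent⇒edge {x} {y} e with volt (layer x) (layer y)
    ... | just s = s , refl , dec-true⁻¹ (elt x ≟ σ (elt y) ∙ s) e

    edge⇒adjacent : ∀ {x y} → Edge x y → adjacent x y ≡ true
    edge⇒adjacent {x} {y} (s , v , e) rewrite v = dec-true (elt x ≟ σ (elt y) ∙ s) e

    edge-sym : ∀ {x y} → Edge x y → Edge y x
    edge-sym {x} {y} (s , v , e) = τ s , volt-sym _ _ v , x≈z//y (elt y) (σ s) (σ (elt x)) (begin
      elt y ∙ σ s            ≡⟨ cong (_∙ σ s) (σ-involutive (elt y)) ⟨
      σ (σ (elt y)) ∙ σ s    ≡⟨ σ-∙ (σ (elt y)) s ⟨
      σ (σ (elt y) ∙ s)      ≡⟨ cong σ e ⟨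
      σ (elt x)              ∎)
      where open ≡-Reasoning

    Γ : Graph (order * k)
    Γ = record
      { adj = adjacent
      ; sym = λ x y → ⇔→≡ (mk⇔ (edge⇒adjacent {y} {x} ∘ edge-sym {x} {y} ∘ adjacent⇒edge)
                              (edge⇒adjacent {x} {y} ∘ edge-sym {y} {x} ∘ adjacent⇒edge))
      ; loopless = λ x → cong (maybe _ false) (volt-loopless (layer x))
      }

    adjacent-vertex : ∀ {i j s} g → volt i j ≡ just s → adjacent (vertex (σ g ∙ s) i) (vertex g j) ≡ true
    adjacent-vertex {i} {j} {s} g v = edge⇒adjacent (s ,
      trans (cong₂ volt (layer-vertex _ i) (layer-vertex g j)) v ,
      trans (elt-vertex _ i) (cong (λ h → σ h ∙ s) (sym (elt-vertex g j))))

    -- The two layers determine the voltage, after which cancellation and injectivity of `σ`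
    -- determine the group element.
    adjacent-unique : ∀ {x y z} → adjacent x y ≡ true → adjacent x z ≡ true → layer y ≡ layer z → y ≡ z
    adjacent-unique {x} {y} {z} p q l with adjacent⇒edge {x} {y} p | adjacent⇒edge {x} {z} q
    ... | s , v , e | s′ , v′ , e′ = vertex-≡ (σ-injective (∙-cancelʳ s _ _ (begin
      σ (elt y) ∙ s    ≡⟨ e ⟨
      elt x            ≡⟨ e′ ⟩
      σ (elt z) ∙ s′   ≡⟨ cong (σ (elt z) ∙_) (just-injective (trans (sym v′) (trans (cong (volt (layer x)) (sym l)) v))) ⟩
      σ (elt z) ∙ s    ∎))) l
      where open ≡-Reasoning

    Linked : Fin k → Fin k → Set
    Linked i j = Σ (Fin order) λ s → volt i j ≡ just s

    adjacent⇒linked : ∀ x y → adjacent x y ≡ true → Linked (layer x) (layer y)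
    adjacent⇒linked x y e = let s , v , _ = adjacent⇒edge {x} {y} e in s , v

    neighbour : ∀ x {j} → Linked (layer x) j → Σ Vertex λ y → adjacent x y ≡ true × layer y ≡ j
    neighbour x {j} (s , v) = vertex g j , subst (λ z → adjacent z (vertex g j) ≡ true) x≡ (adjacent-vertex g v) , layer-vertex g j
      where
      -- The solution of `elt x ≡ σ g ∙ s`.
      g = σ (elt x ∙ s ⁻¹)
      x≡ : vertex (σ g ∙ s) (layer x) ≡ x
      x≡ = trans (cong (λ h → vertex h (layer x))
        (trans (cong (_∙ s) (σ-involutive _)) (//-rightDividesˡ s (elt x)))) (vertex-η x)

    translate : Fin order → Vertex → Vertex
    translate a x = vertex (a ∙ elt x) (layer x)

    elt-translate : ∀ a x → elt (translate a x) ≡ a ∙ elt x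
    elt-translate a x = elt-vertex _ _

    layer-translate : ∀ a x → layer (translate a x) ≡ layer x
    layer-translate a x = layer-vertex _ _

    translate-∙ : ∀ a b x → translate (a ∙ b) x ≡ translate a (translate b x)
    translate-∙ a b x = cong₂ vertex
      (trans (assoc a b (elt x)) (cong (a ∙_) (sym (elt-translate b x)))) (sym (layer-translate b x))

    translate-ε : ∀ x → translate ε x ≡ x
    translate-ε x = trans (cong (λ h → vertex h (layer x)) (identityˡ (elt x))) (vertex-η x)

    translate-injective : ∀ {a b} x → translate a x ≡ translate b x → a ≡ b
    translate-injective {a} {b} x eq = ∙-cancelʳ (elt x) a b
      (trans (sym (elt-translate a x)) (trans (cong elt eq) (elt-translate b x)))

    -- Since `σ (a ∙ g) ∙ s` is `σ a ∙ (σ g ∙ s)`, both sides of the edge equation are multiplied on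
    -- the left by `σ a`.
    translate-preserves : ∀ a x y → adjacent (translate (σ a) x) (translate a y) ≡ adjacent x y
    translate-preserves a x y = ⇔→≡ (mk⇔ (edge⇒adjacent ∘ untranslate ∘ adjacent⇒edge) (edge⇒adjacent ∘ retranslate ∘ adjacent⇒edge))
      where
      volt-eq : volt (layer (translate (σ a) x)) (layer (translate a y)) ≡ volt (layer x) (layer y)
      volt-eq = cong₂ volt (layer-translate (σ a) x) (layer-translate a y)
      rhs : ∀ s → σ (elt (translate a y)) ∙ s ≡ σ a ∙ (σ (elt y) ∙ s)
      rhs s = trans (cong (λ h → σ h ∙ s) (elt-translate a y)) (trans (cong (_∙ s) (σ-∙ a (elt y))) (assoc _ _ s))
      untranslate : Edge (translate (σ a) x) (translate a y) → Edge x y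
      untranslate (s , v , e) = s , trans (sym volt-eq) v ,
        ∙-cancelˡ (σ a) _ _ (trans (sym (elt-translate (σ a) x)) (trans e (rhs s)))
      retranslate : Edge x y → Edge (translate (σ a) x) (translate a y)
      retranslate (s , v , e) = s , trans volt-eq v ,
        trans (elt-translate (σ a) x) (trans (cong (σ a ∙_) e) (sym (rhs s)))

    translation : Fin order → Permutation′ (order * k)
    translation a = permutation (translate a) (translate (a ⁻¹))
      (λ x → trans (sym (translate-∙ a (a ⁻¹) x)) (trans (cong (λ b → translate b x) (inverseʳ a)) (translate-ε x)))
      (λ x → trans (sym (translate-∙ (a ⁻¹) a x)) (trans (cong (λ b → translate b x) (inverseˡ a)) (translate-ε x)))

    -- With `translate (σ a) v` as the witness, γ(φ(a)) = φ(σ(a)) holds by `refl`.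
    φ : Fin order → AutPi Γ
    φ a = translation a , λ v → translate (σ a) v , tabulate-cong λ w →
      trans (sym (translate-preserves a v (translate (a ⁻¹) w)))
            (cong (adjacent (translate (σ a) v)) (Perm.inverseʳ (translation a)))

    -- Rigidity is assumed for every `Symmetry` rather than for `AutPi` alone: passing from `AutPi`
    -- to symmetries needs reducedness, which is itself deduced from rigidity here.
    module _ (rigid : ∀ t → Σ (Fin order) λ a → ∀ x → Symmetry.α {Γ = Γ} t x ≡ translate a x × Symmetry.β t x ≡ translate (σ a) x) where

      -- For a twin swap `β` is the identity, so `σ a` and hence `a` is `ε`. Then `α` is the
      -- identity too, yet it takes `x` to `y`.
      reduced : Reduced Γ
      reduced x y eq with twinSymmetry Γ x y (N-injective Γ eq)
      ... | t , moves , fixes with rigid t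
      ...   | a , acts = begin
        x               ≡⟨ translate-ε x ⟨
        translate ε x   ≡⟨ cong (λ b → translate b x) a≡ε ⟨
        translate a x   ≡⟨ proj₁ (acts x) ⟨
        Symmetry.α t x  ≡⟨ moves ⟩
        y               ∎
        where
        open ≡-Reasoning
        a≡ε : a ≡ ε
        a≡ε = σ-injective (trans (translate-injective x
          (trans (sym (proj₂ (acts x))) (trans (fixes x) (sym (translate-ε x))))) (sym σ-ε))

      φ-surjective : ∀ p → Σ (Fin order) λ a → _≈π_ Γ (φ a) p
      φ-surjective p with rigid (autSymmetry Γ reduced p)
      -- The projection itself is the `β` component, which translates by `σ a`; the element `a`
      -- belongs to γ(p).
      ... | a , acts = σ a , λ x → sym (proj₂ (acts x))

      isHσGraph : Fin k → IsHσGraph H σ Γ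
      isHσGraph i = reduced , φ , translate-∙ ,
        (λ a b eq → translate-injective (vertex ε i) (eq (vertex ε i))) , φ-surjective , λ _ _ → refl

      orbit-layer : ∀ {v w} → InOrbit Γ v w → layer w ≡ layer v
      orbit-layer {v} (p , refl) with φ-surjective p
      ... | a , acts = trans (cong layer (sym (acts v))) (layer-translate a v)

      orbitSize : ∀ v → OrbitSize Γ v order
      orbitSize v = (λ a → translate a v) , (λ _ _ → translate-injective v) , (λ a → φ a , refl) , λ where
        w (p , refl) → let a , acts = φ-surjective p in a , acts v

      orbit-edgeless : ∀ v w w′ → InOrbit Γ v w → InOrbit Γ v w′ → adjacent w w′ ≡ false
      orbit-edgeless v w w′ o o′ = cong (maybe _ false)
        (trans (cong₂ volt (orbit-layer o) (orbit-layer o′)) (volt-loopless (layer v)))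

-- The base graph: hub, leaf and rim path.

if-just⁻¹ : ∀ {P A : Set} (P? : Dec P) {x y : A} →
  (if does P? then just x else nothing) ≡ just y → P × x ≡ y
if-just⁻¹ (yes p) e = p , just-injective e

three-booleans : ∀ {x y z : Bool} → x ≢ y → y ≢ z → ¬ (x ≢ z)
three-booleans x≢y y≢z x≢z = x≢z (trans (¬-not x≢y) (sym (¬-not (y≢z ∘ sym))))

pattern rim i = suc (suc i)
pattern outer j = suc (suc (suc (suc (suc (suc j)))))

module Wheel (H : FiniteGroup) (σ : Fin (FiniteGroup.order H) → Fin (FiniteGroup.order H))
  (σ-∙ : ∀ x y → σ (FiniteGroup._∙_ H x y) ≡ FiniteGroup._∙_ H (σ x) (σ y))
  (σ-involutive : ∀ x → σ (σ x) ≡ x)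
  {K : ℕ} (s : Fin K → Fin (FiniteGroup.order H))
  (S : Subset (FiniteGroup.order H)) (S-generates : Generates H S)
  (s-covers : ∀ {x} → x ∈ S → ∃ λ j → s j ≡ x) where

  open Twisted H σ σ-∙ σ-involutive

  -- Layer 0 is the hub, layer 1 a leaf attached to it, layers 2, 3, … the rim
  -- path; the hub misses layer 3, and the spokes from layer 6 on carry s.
  spoke : Fin (5 + K) → Maybe (Fin order)
  spoke 0F = just ε
  spoke 1F = just ε
  spoke 2F = nothing
  spoke 3F = just ε
  spoke 4F = just ε
  spoke (suc (suc (suc (suc (suc j))))) = just (s j)

  Consecutive : ∀ {n} → Fin n → Fin n → Set
  Consecutive i j = toℕ i ≡ suc (toℕ j) ⊎ toℕ j ≡ suc (toℕ i)

  consecutive? : ∀ {n} (i j : Fin n) → Dec (Consecutive i j)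
  consecutive? i j = (toℕ i ℕ.≟ suc (toℕ j)) ⊎-dec (toℕ j ℕ.≟ suc (toℕ i))

  volt : Fin (6 + K) → Fin (6 + K) → Maybe (Fin order)
  volt zero    zero    = nothing
  volt zero    (suc j) = spoke j
  volt (suc i) zero    = Maybe.map τ (spoke i)
  volt (suc zero) (suc j) = nothing
  volt (rim i) (suc zero) = nothing
  volt (rim i) (rim j) = if does (consecutive? i j) then just ε else nothing

  volt-rim : ∀ i j → Consecutive i j → volt (rim i) (rim j) ≡ just ε
  volt-rim i j c rewrite dec-true (consecutive? i j) c = refl

  volt-rim⁻¹ : ∀ i j {x} → volt (rim i) (rim j) ≡ just x → Consecutive i j × ε ≡ x
  volt-rim⁻¹ i j v = if-just⁻¹ (consecutive? i j) v

  volt-sym : ∀ i j {x} → volt i j ≡ just x → volt j i ≡ just (τ x)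
  volt-sym zero    (suc j) v = cong (Maybe.map τ) v
  volt-sym (suc i) zero    v with spoke i
  volt-sym (suc i) zero refl | just y = cong just (sym (τ-involutive y))
  volt-sym (rim i) (rim j) v with volt-rim⁻¹ i j v
  ... | c , refl = trans (volt-rim j i (swap c)) (cong just (sym τ-ε))

  volt-loopless : ∀ i → volt i i ≡ nothing
  volt-loopless zero = refl
  volt-loopless (suc zero) = refl
  volt-loopless (rim i) = cong (if_then just ε else nothing)
    (dec-false (consecutive? i i) (ℕ.1+n≢n ∘ [ sym , sym ]′))

  open VoltageGraph volt volt-sym volt-loopless public

  link-sym : ∀ i j → Linked i j → Linked j i
  link-sym i j (x , v) = τ x , volt-sym i j v

  volt-up : (i : Fin (3 + K)) → volt (rim (inject₁ i)) (rim (suc i)) ≡ just ε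
  volt-up i = volt-rim (inject₁ i) (suc i) (inj₂ (cong suc (sym (toℕ-inject₁ i))))

  volt-down : (i : Fin (3 + K)) → volt (rim (suc i)) (rim (inject₁ i)) ≡ just ε
  volt-down i = volt-rim (suc i) (inject₁ i) (inj₁ (cong suc (sym (toℕ-inject₁ i))))

  -- The links used, from the hub to the leaf, from the hub to layer 2 and along the rim, form a
  -- spanning tree of voltage `ε`.
  layer-induction : (P : Fin (6 + K) → Set) → P 0F →
    (∀ i j → volt i j ≡ just ε → P i → P j) → ∀ i → P i
  layer-induction P P0 transport zero = P0
  layer-induction P P0 transport (suc zero) = transport 0F 1F refl P0
  layer-induction P P0 transport (rim i) =
    <-weakInduction (λ i → P (rim i)) (transport 0F 2F refl P0)
      (λ i → transport _ _ (volt-up i)) i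

  -- Degree singles out the leaf. An outer layer has its spoke and its predecessor on the rim, so
  -- the last rim layer needs no special case.
  two-links : ∀ i → i ≡ 1F ⊎ ∃₂ λ j j′ → j ≢ j′ × Linked i j × Linked i j′
  two-links 0F = inj₂ (1F , 2F , (λ ()) , (_ , refl) , (_ , refl))
  two-links 1F = inj₁ refl
  two-links 2F = inj₂ (0F , 3F , (λ ()) , (_ , refl) , (_ , refl))
  two-links 3F = inj₂ (2F , 4F , (λ ()) , (_ , refl) , (_ , refl))
  two-links 4F = inj₂ (0F , 3F , (λ ()) , (_ , refl) , (_ , refl))
  two-links 5F = inj₂ (0F , 4F , (λ ()) , (_ , refl) , (_ , refl))
  two-links (outer j) =
    inj₂ (0F , rim (suc (suc (suc (inject₁ j)))) , (λ ()) , (_ , refl) ,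
      (ε , volt-down (suc (suc (suc j)))))

  links-1 : ∀ i → Linked i 1F → i ≡ 0F
  links-1 zero _ = refl
  links-1 (suc zero) (_ , ())
  links-1 (rim i) (_ , ())

  links-3 : ∀ i → Linked i 3F → i ≡ 2F ⊎ i ≡ 4F
  links-3 2F _ = inj₁ refl
  links-3 4F _ = inj₂ refl

  links-2 : ∀ i → Linked i 2F → i ≡ 0F ⊎ i ≡ 3F
  links-2 0F _ = inj₁ refl
  links-2 3F _ = inj₂ refl

  -- The missing spoke singles out layer 3 among the layers other than the hub.
  hub-links : ∀ i → i ≡ 0F ⊎ i ≡ 3F ⊎ Linked i 0F
  hub-links 0F = inj₁ refl
  hub-links 1F = inj₂ (inj₂ (_ , refl))
  hub-links 2F = inj₂ (inj₂ (_ , refl))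
  hub-links 3F = inj₂ (inj₁ refl)
  hub-links 4F = inj₂ (inj₂ (_ , refl))
  hub-links 5F = inj₂ (inj₂ (_ , refl))
  hub-links (outer j) = inj₂ (inj₂ (_ , refl))

  rim-links : ∀ j (i : Fin (2 + K)) → Linked j (rim (suc (inject₁ i))) →
    j ≡ 0F ⊎ j ≡ rim (inject₁ (inject₁ i)) ⊎ j ≡ rim (suc (suc i))
  rim-links zero i _ = inj₁ refl
  rim-links (rim j) i (_ , v) with proj₁ (volt-rim⁻¹ j (suc (inject₁ i)) v)
  ... | inj₁ up = inj₂ (inj₂ (cong (λ l → suc (suc l))
    (toℕ-injective (trans up (cong (λ l → suc (suc l)) (toℕ-inject₁ i))))))
  ... | inj₂ down = inj₂ (inj₁ (cong (λ l → suc (suc l))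
    (toℕ-injective (trans (sym (ℕ.suc-injective down)) (sym (toℕ-inject₁ (inject₁ i)))))))

  -- Every symmetry preserves every layer.

  open Symmetry

  -- Quantifying over all `t` makes a condition on `α` cover `β` and both inverses, by way of
  -- `exchange` and `inverse`.
  Invariant : Fin (6 + K) → Set
  Invariant i = ∀ t {x} → layer x ≡ i → layer (α {Γ = Γ} t x) ≡ i

  invariant⁻¹ : ∀ {i} → Invariant i → ∀ t {x} → layer (α t x) ≡ i → layer x ≡ i
  invariant⁻¹ {i} fixed t {x} l = subst (λ y → layer y ≡ i) (α⁻-α t x) (fixed (inverse Γ t) l)

  -- A neighbour of `x` in layer `j` is sent by `β` to a neighbour of `α t x`, still in layer `j` by
  -- invariance.
  push-link : ∀ {j} → Invariant j → ∀ t x → Linked (layer x) j → Linked (layer (α t x)) j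
  push-link fixed t x link with neighbour x link
  ... | y , e , l = subst (Linked (layer (α t x))) (fixed (exchange Γ t) l)
    (adjacent⇒linked (α t x) (β t y) (trans (preserves t x y) e))

  pull-link : ∀ {j} → Invariant j → ∀ t x → Linked (layer (α t x)) j → Linked (layer x) j
  pull-link {j} fixed t x link =
    subst (λ y → Linked (layer y) j) (α⁻-α t x) (push-link fixed (inverse Γ t) (α t x) link)

  -- All neighbours of a leaf vertex lie in the hub layer, so there is at most one. An image outside
  -- the leaf layer would have neighbours in two distinct layers, and `β⁻` would identify them.
  invariant-leaf : Invariant 1F
  invariant-leaf t {x} l with two-links (layer (α t x))
  ... | inj₁ leaf = leaf
  ... | inj₂ (j , j′ , j≢j′ , link , link′) with neighbour (α t x) link | neighbour (α t x) link′
  ...   | y , e , refl | y′ , e′ , refl = contradiction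
    (cong layer (trans (sym (β-β⁻ t y)) (trans (cong (β t) pulled) (β-β⁻ t y′)))) j≢j′
    where
    at-hub : ∀ z → adjacent x z ≡ true → layer z ≡ 0F
    at-hub z e = links-1 (layer z) (link-sym 1F (layer z) (subst (λ i → Linked i (layer z)) l (adjacent⇒linked x z e)))
    pulled : β⁻ t y ≡ β⁻ t y′
    pulled = adjacent-unique {x} (preserves-pull t x y e) (preserves-pull t x y′ e′)
      (trans (at-hub _ (preserves-pull t x y e)) (sym (at-hub _ (preserves-pull t x y′ e′))))

  invariant-hub : Invariant 0F
  invariant-hub t {x} l = links-1 _ (push-link invariant-leaf t x (subst (λ i → Linked i 1F) (sym l) (ε , refl)))

  -- The hub layer is invariant, so having no link to it is preserved; by `hub-links` only layer 3
  -- and the hub itself qualify.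
  invariant-gap : Invariant 3F
  invariant-gap t {x} l with hub-links (layer (α t x))
  ... | inj₁ hub = contradiction (trans (sym l) (invariant⁻¹ invariant-hub t hub)) λ ()
  ... | inj₂ (inj₁ gap) = gap
  ... | inj₂ (inj₂ link) with subst (λ i → Linked i 0F) l (pull-link invariant-hub t x link)
  ...   | _ , ()

  -- Layers 2 and 4 are told apart by the neighbour of layer 4 in layer 5: all
  -- neighbours of layer 2 lie in the invariant layers 0 and 3.
  invariant-end : Invariant 2F
  invariant-end t {x} l with links-3 _ (push-link invariant-gap t x (subst (λ i → Linked i 3F) (sym l) (ε , refl)))
  ... | inj₁ end = end
  ... | inj₂ four with neighbour (α t x) (subst (λ i → Linked i 5F) (sym four) (ε , refl))
  ...   | y , e , l′ with links-2 (layer (β⁻ t y))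
            (link-sym 2F (layer (β⁻ t y)) (subst (λ i → Linked i (layer (β⁻ t y))) l (adjacent⇒linked x (β⁻ t y) (preserves-pull t x y e))))
  ...     | inj₁ hub = contradiction (trans (sym l′) (invariant⁻¹ invariant-hub (inverse Γ (exchange Γ t)) hub)) λ ()
  ...     | inj₂ gap = contradiction (trans (sym l′) (invariant⁻¹ invariant-gap (inverse Γ (exchange Γ t)) gap)) λ ()

  -- The image keeps a link to the middle layer, so it lies in the hub, one step below the middle or
  -- one step above it. The first two are excluded because those layers are already invariant.
  invariant-rim-step : (i : Fin (2 + K)) → Invariant (rim (inject₁ (inject₁ i))) →
    Invariant (rim (suc (inject₁ i))) → Invariant (rim (suc (suc i)))
  invariant-rim-step i fixed fixed′ t {x} l with rim-links (layer (α t x)) i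
    (push-link fixed′ t x (subst (λ j → Linked j _) (sym l) (ε , volt-down (suc i))))
  ... | inj₁ hub = contradiction (trans (sym l) (invariant⁻¹ invariant-hub t hub)) λ ()
  ... | inj₂ (inj₁ below) = contradiction (trans (sym l) (invariant⁻¹ fixed t below)) two-apart
    where
    two-apart : rim (suc (suc i)) ≢ rim (inject₁ (inject₁ i))
    two-apart eq = ℕ.<⇒≢ (ℕ.m≤n⇒m≤1+n ℕ.≤-refl) (trans
      (sym (trans (toℕ-inject₁ (inject₁ i)) (toℕ-inject₁ i)))
      (sym (ℕ.suc-injective (ℕ.suc-injective (cong toℕ eq)))))
  ... | inj₂ (inj₂ above) = above

  invariant-rim : (i : Fin (3 + K)) →
    Invariant (rim (inject₁ i)) × Invariant (rim (suc i))
  -- The induction carries two consecutive layers because each step relies on both predecessors.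
  invariant-rim = <-weakInduction _ (invariant-end , invariant-gap)
    λ i (fixed , fixed′) → fixed′ , invariant-rim-step i fixed fixed′

  invariant : ∀ i → Invariant i
  invariant zero = invariant-hub
  invariant (suc zero) = invariant-leaf
  invariant (rim zero) = invariant-end
  invariant (rim (suc i)) = proj₂ (invariant-rim i)

  -- Rigidity: every symmetry is a pair of left translations.

  module _ (t : Symmetry Γ) where

    A B : Fin (6 + K) → Fin order → Fin order
    A i h = elt (α t (vertex h i))
    B i h = elt (β t (vertex h i))

    -- The image edge joins the same two layers by invariance, hence carries the same voltage `x`.
    link-action : ∀ {i j x} g → volt i j ≡ just x → A i (σ g ∙ x) ≡ σ (B j g) ∙ x
    link-action {i} {j} {x} g v with adjacent⇒edge {α t (vertex (σ g ∙ x) i)} {β t (vertex g j)}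
      (trans (preserves t _ _) (adjacent-vertex g v))
    ... | y , w , e = trans e (cong (σ (B j g) ∙_) (just-injective (trans (sym w)
      (trans (cong₂ volt (invariant i t (layer-vertex _ i)) (invariant j (exchange Γ t) (layer-vertex g j))) v))))

    ε-link-action : ∀ {i j} g → volt i j ≡ just ε → A i (σ g) ≡ σ (B j g)
    ε-link-action {i} g v = trans (cong (A i) (sym (identityʳ (σ g)))) (trans (link-action g v) (identityʳ _))

  -- The odd cycle of ε-links through layers 0, 4 and 5 ties A to B.
  module _ (t : Symmetry Γ) where

    A-triangle : ∀ g → A t 4F (σ g) ≡ A t 0F (σ g)
    A-triangle g = trans (ε-link-action t {4F} {5F} g refl) (sym (ε-link-action t {0F} {5F} g refl))

    -- The link from layer 0 to layer 4 trades `B` for `A`; `A-triangle` then returns to layer 0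
    -- without trading back.
    B-hub : ∀ h → B t 0F h ≡ σ (A t 0F (σ h))
    B-hub h = begin
      B t 0F h           ≡⟨ cong (B t 0F) (σ-involutive h) ⟨
      B t 0F (σ (σ h))   ≡⟨ ε-link-action (exchange Γ t) {0F} {4F} (σ h) refl ⟩
      σ (A t 4F (σ h))   ≡⟨ cong σ (A-triangle h) ⟩
      σ (A t 0F (σ h))   ∎
      where open ≡-Reasoning

    -- Crossing an `ε`-link trades `A` for `B` up to conjugation by `σ`, and `B-hub` undoes the
    -- trade, so agreement with the hub spreads along the spanning tree.
    layers-agree : ∀ i h → A t i h ≡ A t 0F h × B t i h ≡ B t 0F h
    layers-agree = layer-induction _ (λ _ → refl , refl) λ i j v agree h → (begin
        A t j h                  ≡⟨ σ-involutive _ ⟨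
        σ (σ (A t j h))          ≡⟨ cong σ (ε-link-action (exchange Γ t) h v) ⟨
        σ (B t i (σ h))          ≡⟨ cong σ (proj₂ (agree (σ h))) ⟩
        σ (B t 0F (σ h))         ≡⟨ cong σ (B-hub (σ h)) ⟩
        σ (σ (A t 0F (σ (σ h)))) ≡⟨ σ-involutive _ ⟩
        A t 0F (σ (σ h))         ≡⟨ cong (A t 0F) (σ-involutive h) ⟩
        A t 0F h                 ∎) , (begin
        B t j h                  ≡⟨ σ-involutive _ ⟨
        σ (σ (B t j h))          ≡⟨ cong σ (ε-link-action t h v) ⟨
        σ (A t i (σ h))          ≡⟨ cong σ (proj₁ (agree (σ h))) ⟩
        σ (A t 0F (σ h))         ≡⟨ B-hub h ⟨
        B t 0F h                 ∎)
      where open ≡-Reasoning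

    A-spoke : ∀ j x → A t 0F (x ∙ s j) ≡ A t 0F x ∙ s j
    A-spoke j x = begin
      A t 0F (x ∙ s j)            ≡⟨ cong (λ y → A t 0F (y ∙ s j)) (σ-involutive x) ⟨
      A t 0F (σ (σ x) ∙ s j)      ≡⟨ link-action t (σ x) spoke-j ⟩
      σ (B t (outer j) (σ x)) ∙ s j   ≡⟨ cong (λ y → σ y ∙ s j) (proj₂ (layers-agree (outer j) (σ x))) ⟩
      σ (B t 0F (σ x)) ∙ s j      ≡⟨ cong (λ y → σ y ∙ s j) (B-hub (σ x)) ⟩
      σ (σ (A t 0F (σ (σ x)))) ∙ s j ≡⟨ cong (_∙ s j) (σ-involutive _) ⟩
      A t 0F (σ (σ x)) ∙ s j      ≡⟨ cong (λ y → A t 0F y ∙ s j) (σ-involutive x) ⟩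
      A t 0F x ∙ s j              ∎
      where
      open ≡-Reasoning
      spoke-j : volt 0F (outer j) ≡ just (s j)
      spoke-j = refl

    -- The elements whose right multiplication commutes with `A t 0F` form a subgroup, and it
    -- contains `S` by `A-spoke`. The products and inverses need the claim at shifted `x`, hence the
    -- inner quantifier.
    A-generated : ∀ {y} → Generated H S y → ∀ x → A t 0F (x ∙ y) ≡ A t 0F x ∙ y
    A-generated (gen y∈S) x with s-covers y∈S
    ... | j , refl = A-spoke j x
    A-generated one x = trans (cong (A t 0F) (identityʳ x)) (sym (identityʳ _))
    A-generated (mul {y} {z} p q) x = begin
      A t 0F (x ∙ (y ∙ z))   ≡⟨ cong (A t 0F) (assoc x y z) ⟨
      A t 0F ((x ∙ y) ∙ z)   ≡⟨ A-generated q (x ∙ y) ⟩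
      A t 0F (x ∙ y) ∙ z     ≡⟨ cong (_∙ z) (A-generated p x) ⟩
      (A t 0F x ∙ y) ∙ z     ≡⟨ assoc _ y z ⟩
      A t 0F x ∙ (y ∙ z)     ∎
      where open ≡-Reasoning
    A-generated (inv {y} p) x = x≈z//y _ y _
      (trans (sym (A-generated p (x ∙ y ⁻¹))) (cong (A t 0F) (//-rightDividesˡ y x)))

    A-left : ∀ h → A t 0F h ≡ A t 0F ε ∙ h
    A-left h = trans (cong (A t 0F) (sym (identityˡ h))) (A-generated (S-generates h) ε)

  -- The translating element is the image of `ε` in the hub layer. Conjugating left multiplication
  -- by `a` with `σ`, as `B-hub` prescribes, gives left multiplication by `σ a`.
  rigid : ∀ t → Σ (Fin order) λ a → ∀ x → α t x ≡ translate a x × β t x ≡ translate (σ a) x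
  rigid t = a , λ x →
    vertex-≡
      (trans (cong (elt ∘ α t) (sym (vertex-η x))) (trans (proj₁ (layers-agree t (layer x) (elt x)))
        (trans (A-left t (elt x)) (sym (elt-translate a x)))))
      (trans (invariant _ t refl) (sym (layer-translate a x))) ,
    vertex-≡
      (trans (cong (elt ∘ β t) (sym (vertex-η x))) (trans (proj₂ (layers-agree t (layer x) (elt x)))
        (trans (B-left (elt x)) (sym (elt-translate (σ a) x)))))
      (trans (invariant _ (exchange Γ t) refl) (sym (layer-translate (σ a) x)))
    where
    open ≡-Reasoning
    a = A t 0F ε
    B-left : ∀ h → B t 0F h ≡ σ a ∙ h
    B-left h = begin
      B t 0F h            ≡⟨ B-hub t h ⟩
      σ (A t 0F (σ h))    ≡⟨ cong σ (A-left t (σ h)) ⟩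
      σ (a ∙ σ h)         ≡⟨ σ-∙ a (σ h) ⟩
      σ a ∙ σ (σ h)       ≡⟨ cong (σ a ∙_) (σ-involutive h) ⟩
      σ a ∙ h             ∎

  -- Connectedness and nonbipartiteness.

  ε-adjacent : ∀ {i j} g → volt i j ≡ just ε → adjacent (vertex (σ g) i) (vertex g j) ≡ true
  ε-adjacent {i} {j} g v =
    subst (λ h → adjacent (vertex h i) (vertex g j) ≡ true) (identityʳ (σ g)) (adjacent-vertex g v)

  reachable-ε : ∀ {i j} g → volt i j ≡ just ε → Reachable Γ (vertex (σ g) i) (vertex g j)
  reachable-ε g v = reachable-edge Γ (ε-adjacent g v)

  -- Each `ε`-link applies `σ` to the group element, so going once round the triangle of layers 0, 4
  -- and 5 applies it three times, that is, once.
  reachable-σ : ∀ h → Reachable Γ (vertex (σ h) 0F) (vertex h 0F)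
  reachable-σ h = reachable-trans Γ (reachable-ε {0F} {4F} h refl) (reachable-trans Γ
    (subst (λ g → Reachable Γ (vertex g 4F) (vertex (σ h) 5F)) (σ-involutive h) (reachable-ε {4F} {5F} (σ h) refl))
    (reachable-ε {5F} {0F} h (cong just τ-ε)))

  reachable-hub : ∀ i h → Reachable Γ (vertex h i) (vertex h 0F)
  reachable-hub = layer-induction _ (λ _ → here) λ i j v reach h →
    reachable-trans Γ (reachable-sym Γ (reachable-ε h v)) (reachable-trans Γ (reach (σ h)) (reachable-σ h))

  reachable-spoke : ∀ j x → Reachable Γ (vertex (x ∙ s j) 0F) (vertex x 0F)
  reachable-spoke j x = reachable-trans Γ
    (subst (λ y → Reachable Γ (vertex (y ∙ s j) 0F) (vertex (σ x) (outer j))) (σ-involutive x)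
      (reachable-edge Γ (adjacent-vertex {0F} {outer j} (σ x) refl)))
    (reachable-trans Γ (reachable-hub (outer j) (σ x)) (reachable-σ x))

  -- Spokes realise right multiplication by the generators inside the hub layer; concatenating and
  -- reversing paths handles products and inverses.
  reachable-generated : ∀ {y} → Generated H S y → ∀ x → Reachable Γ (vertex (x ∙ y) 0F) (vertex x 0F)
  reachable-generated (gen y∈S) x with s-covers y∈S
  ... | j , refl = reachable-spoke j x
  reachable-generated one x = subst (λ y → Reachable Γ (vertex y 0F) (vertex x 0F)) (sym (identityʳ x)) here
  reachable-generated (mul {y} {z} p q) x = reachable-trans Γ
    (subst (λ w → Reachable Γ (vertex w 0F) (vertex (x ∙ y) 0F)) (assoc x y z) (reachable-generated q (x ∙ y)))
    (reachable-generated p x)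
  reachable-generated (inv {y} p) x = reachable-sym Γ
    (subst (λ w → Reachable Γ (vertex w 0F) (vertex (x ∙ y ⁻¹) 0F)) (//-rightDividesˡ y x)
      (reachable-generated p (x ∙ y ⁻¹)))

  connected : Connected Γ
  connected x y = reachable-trans Γ (to-base x) (reachable-sym Γ (to-base y))
    where
    to-base : ∀ x → Reachable Γ x (vertex ε 0F)
    to-base x = subst (λ v → Reachable Γ v (vertex ε 0F)) (vertex-η x) (reachable-trans Γ
      (reachable-hub (layer x) (elt x))
      (subst (λ h → Reachable Γ (vertex h 0F) (vertex ε 0F)) (identityˡ (elt x))
        (reachable-generated (S-generates (elt x)) ε)))

  -- As `σ` fixes `ε`, the triangle of layers 0, 4 and 5 lifts to a triangle over `ε`.
  nonbipartite : ¬ Bipartite Γ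
  nonbipartite (colour , proper) = three-booleans
    (proper _ _ (edge-ε 0F 4F refl)) (proper _ _ (edge-ε 4F 5F refl)) (proper _ _ (edge-ε 0F 5F refl))
    where
    edge-ε : ∀ i j → volt i j ≡ just ε → adjacent (vertex ε i) (vertex ε j) ≡ true
    edge-ε i j v = subst (λ h → adjacent (vertex h i) (vertex ε j) ≡ true) σ-ε (ε-adjacent ε v)

theorem5p13 : (H : FiniteGroup) (σ : Fin (FiniteGroup.order H) → Fin (FiniteGroup.order H))
    → IsAutomorphism H σ → (∀ x → σ (σ x) ≡ x)
    → Σ ℕ λ r → IsRank H r × Σ ℕ λ n → Σ (Graph n) λ Γ →
    IsHσGraph H σ Γ × Connected Γ × ¬ Bipartite Γ
    × n ≡ FiniteGroup.order H * (7 + (r ⊔ 5))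
    × (∀ v → OrbitSize Γ v (FiniteGroup.order H))
    × (∀ v w w′ → InOrbit Γ v w → InOrbit Γ v w′ → Graph.adj Γ w w′ ≡ false)
theorem5p13 H σ (σ-∙ , _) σ-involutive with rank-exists H
... | r , isRank@((S , S-generates , ∣S∣≡r) , _) =
  r , isRank , _ , Γ , isHσGraph rigid 0F , connected , nonbipartite , refl ,
  orbitSize rigid , orbit-edgeless rigid
  where
  -- Taking `K` to be `suc (r ⊔ 5)` makes `6 + K` compute to `7 + (r ⊔ 5)`, so the vertex count is
  -- `refl`. The surplus outer spokes get the default voltage `ε`.
  ∣S∣≤K : ∣ S ∣ ≤ suc (r ⊔ 5)
  ∣S∣≤K = subst (_≤ suc (r ⊔ 5)) (sym ∣S∣≡r) (ℕ.m≤n⇒m≤1+n (ℕ.m≤m⊔n r 5))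
  cover = enumerate S ∣S∣≤K (FiniteGroup.ε H) (λ x → x)
  open Wheel H σ σ-∙ σ-involutive (proj₁ cover) S S-generates (proj₂ cover)
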